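{- For all integers $t,r\ge 2$, the graph $H_{t,r}$ is connected and has \[ n(H_{t,r})=t+2r+2,\qquad m(H_{t,r})=2t+3r+\binom r2,\qquad \Delta(H_{t,r})=t+r, \] \[ \rho(H_{t,r})=1,\qquad \tau_D(H_{t,r})=t+2r+1. \] Moreover, \[ \mu(H_{t,r})=-(t-1)(r-1)<0 . \] Hence every $H_{t,r}$ is a connected graph violating the inequality $\tau_D(G)\le \dfrac{\Delta(\Delta-1)n+2m}{\Delta^2+1}$ (where $n,m,\Delta$ are the order, size and maximum degree of $G$).
   Context: All graphs are finite, simple and undirected. For a graph $G$ write $n=n(G)=|V(G)|$, $m=m(G)=|E(G)|$, and $\Delta=\Delta(G)$ for the maximum degree. A set $T\subseteq V(G)$ is an identifying vertex cover if $e\cap T\neq\emptyset$ for every $e\in E(G)$ and the sets $e\cap T$ ($e\in E(G)$) are pairwise distinct; $\tau_D(G)$ is the minimum cardinality of an identifying vertex cover. A packing is a set of vertices whose distinct members are at pairwise distance at least three (vertices in different components have distance $+\infty$); $\rho(G)$ is the maximum cardinality of a packing. Define $\mu(G)=\Delta(\Delta-1)n+2m-(\Delta^2+1)\tau_D(G)$. For integers $t,r\ge2$, $H_{t,r}$ is the graph on the vertex set $\{a,b\}\cup X\cup C\cup D$ (all vertices distinct), where $X=\{x_1,\dots,x_t\}$, $C=\{c_1,\dots,c_r\}$, $D=\{d_1,\dots,d_r\}$, whose edges are exactly: $ax_i$ and $bx_i$ for $1\le i\le t$; $ac_j$, $c_jd_j$ and $d_jb$ for $1\le j\le r$; and $d_id_j$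 for $1\le i<j\le r$. -}

module Defs where

open import Data.Empty using (⊥-elim)
open import Data.Fin as Fin using (Fin)
import Data.Fin.Properties as Fin
open import Data.Fin.Subset using (Subset; ⁅_⁆; _∩_; _∪_; ∣_∣; Nonempty; ⊤; ⊥) renaming (_∈_ to _∈ˢ_)
open import Data.Fin.Subset.Properties using (anySubset?; nonempty?; _∈?_; ∣p∣≤n; ∩-identityʳ; x∈⁅x⁆; x∈p∪q⁺; ∉⊥)
import Data.Bool.Properties as Bool
open import Data.Integer as ℤ using (ℤ; +_)
open import Data.List using (List; map; filter; length; allFin; cartesianProduct)
open import Data.List.Extrema.Nat using (max)
open import Data.List.Membership.Propositional using (_∈_)
open import Data.List.Membership.Propositional.Properties using (∈-map⁻)
import Data.List.Relation.Unary.All as All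
open import Data.Nat using (ℕ; zero; suc; _+_; _^_; _≤_; z≤n; s≤s)
import Data.Nat.Properties as ℕ
open import Data.Product using (Σ; ∃; _×_; _,_; proj₁; proj₂)
open import Data.Rational as ℚ using (ℚ)
open import Data.Sum using (_⊎_; inj₁; inj₂)
open import Data.Vec using (tabulate)
import Data.Vec.Properties as Vec
open import Function using (_↔_; Inverse; mk↔ₛ′)
open import Function.Construct.Composition using (_↔-∘_)
open import Function.Construct.Identity using (↔-id)
open import Data.Sum.Function.Propositional using (_⊎-↔_)
open import Function.Construct.Symmetry using (↔-sym)
open import Relation.Binary using (Decidable; DecidableEquality; Symmetric; Irreflexive)
open import Relation.Binary.Construct.Closure.ReflexiveTransitive using (Star; ε; _◅_)
open import Relation.Binary.Construct.Closure.Symmetric as Sym using (SymClosure; fwd; bwd)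
open import Relation.Binary.PropositionalEquality using (_≡_; _≢_; refl; sym; trans; cong; subst)
open import Relation.Nullary using (Dec; yes; no; does)
open import Relation.Nullary.Decidable using (map′; _×-dec_; _⊎-dec_; _→-dec_; ¬?)
open import Relation.Unary using () renaming (Decidable to Decidable₁)

private
  least : {P : ℕ → Set} → Decidable₁ P → (n : ℕ) → P n →
          Σ ℕ λ k → P k × (∀ j → P j → k ≤ j)
  least P? n pn with P? zero
  least P? n       pn | yes p0 = zero , p0 , λ _ _ → z≤n
  least P? zero    pn | no ¬p0 = ⊥-elim (¬p0 pn)
  least {P} P? (suc n) pn | no ¬p0
    with least {λ j → P (suc j)} (λ j → P? (suc j)) n pn
  ... | k , pk , k≤ = suc k , pk , λ
    { zero    p0 → ⊥-elim (¬p0 p0)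
    ; (suc j) pj → s≤s (k≤ j pj) }

  greatest : {P : ℕ → Set} → Decidable₁ P → (n : ℕ) → P n →
             (b : ℕ) → (∀ j → P j → j ≤ b) →
             Σ ℕ λ k → P k × (∀ j → P j → j ≤ k)
  greatest P? n pn b ≤b with P? b
  greatest P? n pn b       ≤b | yes pb = b , pb , ≤b
  greatest {P} P? n pn zero    ≤b | no ¬pb =
    ⊥-elim (¬pb (subst P (ℕ.n≤0⇒n≡0 (≤b n pn)) pn))
  greatest {P} P? n pn (suc b) ≤b | no ¬pb =
    greatest P? n pn b λ j pj →
      ℕ.≤-pred (ℕ.≤∧≢⇒< (≤b j pj) λ j≡ → ¬pb (subst P j≡ pj))

  size? : {n : ℕ} {P : Subset n → Set} → Decidable₁ P →
          Decidable₁ (λ k → ∃ λ S → P S × ∣ S ∣ ≡ k)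
  size? P? k = anySubset? λ S → P? S ×-dec (∣ S ∣ ℕ.≟ k)

minCardinality : {n : ℕ} {P : Subset n → Set} → Decidable₁ P → ∃ P →
  Σ ℕ λ k → (∃ λ S → P S × ∣ S ∣ ≡ k) × (∀ S → P S → k ≤ ∣ S ∣)
minCardinality P? (S , pS) with least (size? P?) ∣ S ∣ (S , pS , refl)
... | k , pk , k≤ = k , pk , λ T pT → k≤ ∣ T ∣ (T , pT , refl)

maxCardinality : {n : ℕ} {P : Subset n → Set} → Decidable₁ P → ∃ P →
  Σ ℕ λ k → (∃ λ S → P S × ∣ S ∣ ≡ k) × (∀ S → P S → ∣ S ∣ ≤ k)
maxCardinality {n} P? (S , pS)
  with greatest (size? P?) ∣ S ∣ (S , pS , refl) n (λ { _ (T , _ , refl) → ∣p∣≤n T })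
... | k , pk , ≤k = k , pk , λ T pT → ≤k ∣ T ∣ (T , pT , refl)

-- The bijection `finite` serves to count and to let sets of vertices be
-- elements of `Subset order`. Decidability of adjacency is no restriction
-- classically.
record Graph : Set₁ where
  infix 4 _~_ _~?_
  field
    V        : Set
    order    : ℕ
    finite   : V ↔ Fin order
    _~_      : V → V → Set
    _~?_     : Decidable _~_
    ~-sym    : Symmetric _~_
    ~-irrefl : Irreflexive _≡_ _~_

  index : V → Fin order
  index = Inverse.to finite

  vertex : Fin order → V
  vertex = Inverse.from finite

  _≟ⱽ_ : DecidableEquality V
  u ≟ⱽ v = map′ (λ eq → trans (sym (Inverse.strictlyInverseʳ finite u))
                          (trans (cong vertex eq) (Inverse.strictlyInverseʳ finite v)))
                (cong index)
                (index u Fin.≟ index v)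

  allⱽ? : {P : V → Set} → Decidable₁ P → Dec (∀ v → P v)
  allⱽ? {P} P? = map′
    (λ h v → subst P (Inverse.strictlyInverseʳ finite v) (h (index v)))
    (λ h i → h (vertex i))
    (Fin.all? λ i → P? (vertex i))

  Connected : Set
  Connected = V × (∀ u v → Star _~_ u v)

  neighbourhood : V → Subset order
  neighbourhood v = tabulate λ i → does (v ~? vertex i)

  degree : V → ℕ
  degree v = ∣ neighbourhood v ∣

  maxDegree : ℕ
  maxDegree = max 0 (map (λ i → degree (vertex i)) (allFin order))

  -- Each edge arises from exactly one pair i < j, so that the list below
  -- enumerates the edges, as two-element sets of vertices, without repetition.
  edgePairs : List (Fin order × Fin order)
  edgePairs = filter (λ (i , j) → (i Fin.<? j) ×-dec (vertex i ~? vertex j))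
                     (cartesianProduct (allFin order) (allFin order))

  edges : List (Subset order)
  edges = map (λ (i , j) → ⁅ i ⁆ ∪ ⁅ j ⁆) edgePairs

  size : ℕ
  size = length edges

  IsIdentifyingVertexCover : Subset order → Set
  IsIdentifyingVertexCover T =
    (∀ e → e ∈ edges → Nonempty (e ∩ T)) ×
    (∀ e f → e ∈ edges → f ∈ edges → e ≢ f → e ∩ T ≢ f ∩ T)

  isIdentifyingVertexCover? : Decidable₁ IsIdentifyingVertexCover
  isIdentifyingVertexCover? T = map′
    (λ (p , q) → (λ e → All.lookup p) , λ e f e∈ f∈ → All.lookup (All.lookup q e∈) f∈)
    (λ (p , q) → All.tabulate (p _) , All.tabulate λ e∈ → All.tabulate λ f∈ → q _ _ e∈ f∈)
    (All.all? (λ e → nonempty? (e ∩ T)) edges ×-dec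
     All.all? (λ e → All.all? (λ f → ¬? (e ≟ f) →-dec ¬? ((e ∩ T) ≟ (f ∩ T))) edges) edges)
    where
    _≟_ : DecidableEquality (Subset order)
    _≟_ = Vec.≡-dec Bool._≟_

  ⊤-isIdentifyingVertexCover : IsIdentifyingVertexCover ⊤
  ⊤-isIdentifyingVertexCover = cov , λ e f _ _ e≢f eq →
    e≢f (trans (sym (∩-identityʳ e)) (trans eq (∩-identityʳ f)))
    where
    cov : ∀ e → e ∈ edges → Nonempty (e ∩ ⊤)
    cov e e∈ with ∈-map⁻ _ e∈
    ... | (i , j) , _ , refl =
      i , subst (i ∈ˢ_) (sym (∩-identityʳ e)) (x∈p∪q⁺ (inj₁ (x∈⁅x⁆ i)))

  τD : ℕ
  τD = proj₁ (minCardinality isIdentifyingVertexCover? (⊤ , ⊤-isIdentifyingVertexCover))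

  walkLength : ∀ {u v} → Star _~_ u v → ℕ
  walkLength ε       = 0
  walkLength (_ ◅ w) = suc (walkLength w)

  -- The distance is the infimum of the lengths of walks from u to v; it is
  -- at least k exactly when k is a lower bound, in particular when no walk
  -- exists.
  Distance≥ : ℕ → V → V → Set
  Distance≥ k u v = (w : Star _~_ u v) → k ≤ walkLength w

  distance≥? : ∀ k → Decidable (Distance≥ k)
  distance≥? zero    u v = yes λ _ → z≤n
  distance≥? (suc k) u v = map′
    (λ { (u≢v , _) ε       → ⊥-elim (u≢v refl)
       ; (_   , h) (a ◅ w) → s≤s (h _ a w) })
    (λ h → (λ { refl → ℕ.n≮0 (h ε) }) , λ x a w → ℕ.≤-pred (h (a ◅ w)))
    (¬? (u ≟ⱽ v) ×-dec allⱽ? λ x → (u ~? x) →-dec distance≥? k x v)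

  IsPacking : Subset order → Set
  IsPacking S = ∀ u v → index u ∈ˢ S → index v ∈ˢ S → u ≢ v → Distance≥ 3 u v

  isPacking? : Decidable₁ IsPacking
  isPacking? S = allⱽ? λ u → allⱽ? λ v →
    (index u ∈? S) →-dec ((index v ∈? S) →-dec (¬? (u ≟ⱽ v) →-dec distance≥? 3 u v))

  ρ : ℕ
  ρ = proj₁ (maxCardinality isPacking? (⊥ , λ _ _ u∈⊥ → ⊥-elim (∉⊥ u∈⊥)))

  μ : ℤ
  μ = + maxDegree ℤ.* (+ maxDegree ℤ.- + 1) ℤ.* + order ℤ.+ + 2 ℤ.* + size
      ℤ.- (+ maxDegree ℤ.* + maxDegree ℤ.+ + 1) ℤ.* + τD

  bound : ℚ
  bound = (+ maxDegree ℤ.* (+ maxDegree ℤ.- + 1) ℤ.* + order ℤ.+ + 2 ℤ.* + size)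
          ℚ./ suc (maxDegree ^ 2)

  SatisfiesBound : Set
  SatisfiesBound = (+ τD ℚ./ 1) ℚ.≤ bound

open Graph public
  using (Connected; order; size; maxDegree; ρ; τD; μ; SatisfiesBound)

data HVertex (t r : ℕ) : Set where
  va vb : HVertex t r
  vx    : Fin t → HVertex t r
  vc vd : Fin r → HVertex t r

-- Each edge in one orientation; adjacency in H t r is the symmetric closure.
data HEdge {t r : ℕ} : HVertex t r → HVertex t r → Set where
  ax : ∀ i → HEdge va (vx i)
  bx : ∀ i → HEdge vb (vx i)
  ac : ∀ j → HEdge va (vc j)
  cd : ∀ j → HEdge (vc j) (vd j)
  db : ∀ j → HEdge (vd j) vb
  dd : ∀ {i j} → i Fin.< j → HEdge (vd i) (vd j)

HEdge? : ∀ {t r} → Decidable (HEdge {t} {r})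
HEdge? va     va     = no λ ()
HEdge? va     vb     = no λ ()
HEdge? va     (vx i) = yes (ax i)
HEdge? va     (vc j) = yes (ac j)
HEdge? va     (vd j) = no λ ()
HEdge? vb     va     = no λ ()
HEdge? vb     vb     = no λ ()
HEdge? vb     (vx i) = yes (bx i)
HEdge? vb     (vc j) = no λ ()
HEdge? vb     (vd j) = no λ ()
HEdge? (vx i) v      = no λ ()
HEdge? (vc i) va      = no λ ()
HEdge? (vc i) vb      = no λ ()
HEdge? (vc i) (vx j) = no λ ()
HEdge? (vc i) (vc j) = no λ ()
HEdge? (vc i) (vd j) = map′ (λ { refl → cd i }) (λ { (cd _) → refl }) (i Fin.≟ j)
HEdge? (vd i) va      = no λ ()
HEdge? (vd i) vb      = yes (db i)
HEdge? (vd i) (vx j) = no λ ()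
HEdge? (vd i) (vc j) = no λ ()
HEdge? (vd i) (vd j) = map′ dd (λ { (dd i<j) → i<j }) (i Fin.<? j)

HEdge-irrefl : ∀ {t r} → Irreflexive _≡_ (HEdge {t} {r})
HEdge-irrefl refl (dd i<i) = Fin.<-irrefl refl i<i

HVertex↔⊎ : ∀ t r → HVertex t r ↔ (Fin 2 ⊎ (Fin t ⊎ (Fin r ⊎ Fin r)))
HVertex↔⊎ t r = mk↔ₛ′ to from to∘from from∘to
  where
  to : HVertex t r → Fin 2 ⊎ (Fin t ⊎ (Fin r ⊎ Fin r))
  to va     = inj₁ Fin.zero
  to vb     = inj₁ (Fin.suc Fin.zero)
  to (vx i) = inj₂ (inj₁ i)
  to (vc j) = inj₂ (inj₂ (inj₁ j))
  to (vd j) = inj₂ (inj₂ (inj₂ j))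

  from : Fin 2 ⊎ (Fin t ⊎ (Fin r ⊎ Fin r)) → HVertex t r
  from (inj₁ Fin.zero)           = va
  from (inj₁ (Fin.suc Fin.zero)) = vb
  from (inj₂ (inj₁ i))           = vx i
  from (inj₂ (inj₂ (inj₁ j)))    = vc j
  from (inj₂ (inj₂ (inj₂ j)))    = vd j

  to∘from : ∀ s → to (from s) ≡ s
  to∘from (inj₁ Fin.zero)           = refl
  to∘from (inj₁ (Fin.suc Fin.zero)) = refl
  to∘from (inj₂ (inj₁ i))           = refl
  to∘from (inj₂ (inj₂ (inj₁ j)))    = refl
  to∘from (inj₂ (inj₂ (inj₂ j)))    = refl

  from∘to : ∀ v → from (to v) ≡ v
  from∘to va     = refl
  from∘to vb     = refl
  from∘to (vx i) = refl
  from∘to (vc j) = refl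
  from∘to (vd j) = refl

HVertex↔Fin : ∀ t r → HVertex t r ↔ Fin (2 + (t + (r + r)))
HVertex↔Fin t r = ↔-sym (unsplit 2 (unsplit t Fin.+↔⊎)) ↔-∘ HVertex↔⊎ t r
  where
  unsplit : ∀ m {n} {A : Set} → Fin n ↔ A → Fin (m + n) ↔ (Fin m ⊎ A)
  unsplit m f = (↔-id _ ⊎-↔ f) ↔-∘ Fin.+↔⊎

H : ℕ → ℕ → Graph
H t r = record
  { V        = HVertex t r
  ; order    = 2 + (t + (r + r))
  ; finite   = HVertex↔Fin t r
  ; _~_      = SymClosure HEdge
  ; _~?_     = λ u v → map′ (λ { (inj₁ e) → fwd e ; (inj₂ e) → bwd e })
                            (λ { (fwd e) → inj₁ e ; (bwd e) → inj₂ e })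
                            (HEdge? u v ⊎-dec HEdge? v u)
  ; ~-sym    = Sym.symmetric HEdge
  ; ~-irrefl = λ { eq (fwd e) → HEdge-irrefl eq e
                 ; eq (bwd e) → HEdge-irrefl (sym eq) e }
  }

{-# OPTIONS --safe #-}
module Submission where

-- A set of vertices is an identifying vertex cover exactly when its complement
-- is a packing, so τD G + ρ G is the order of G. In H t r any two vertices are
-- at distance at most 2, whence ρ = 1 and τD = order - 1. The size is obtained
-- from the degrees by the handshake lemma, and μ is then a polynomial identity.

open import Defs
open import Data.Bool using (Bool; true; false; if_then_else_)
open import Data.Empty using (⊥-elim)
open import Data.Fin as Fin using (Fin; _↑ˡ_; _↑ʳ_)
import Data.Fin.Properties as Fin
open import Data.Fin.Subset using (Subset; ⁅_⁆; _∩_; _∪_; ∣_∣; ∁; _∉_)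
  renaming (_∈_ to _∈ˢ_)
open import Data.Fin.Subset.Properties
  using (_∈?_; nonempty?; ⊆-antisym; Empty-unique; ∣⊥∣≡0; ∣p∣≤n; ∣⁅x⁆∣≡1; p⊆q⇒∣p∣≤∣q∣;
         x∈⁅x⁆; x∈⁅y⁆⇒x≡y; x∈p∪q⁺; x∈p∪q⁻; x∈p∩q⁺; x∈p∩q⁻; ∪-comm;
         x∈∁p⇒x∉p; x∉p⇒x∈∁p; ∣∁p∣≡n∸∣p∣)
open import Data.List as List using (List; length; filter; cartesianProduct; allFin)
open import Data.List.Extrema.Nat using (max≤v⁺; v≤max⁺)
open import Data.List.Membership.Propositional using (_∈_; lose)
open import Data.List.Membership.Propositional.Properties
  using (∈-map⁺; ∈-map⁻; ∈-filter⁺; ∈-filter⁻; ∈-allFin; ∈-cartesianProduct⁺)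
open import Data.List.Properties using (length-++; length-map; filter-++; map-tabulate)
import Data.List.Relation.Unary.All as All
import Data.List.Relation.Unary.All.Properties as All
open import Data.Nat using (ℕ; zero; suc; _+_; _*_; _^_; _≤_; z≤n; s≤s)
open import Data.Nat.Combinatorics using (_C_; nC1≡n; nCk+nC[k+1]≡[n+1]C[k+1])
import Data.Nat as ℕ
import Data.Nat.Properties as ℕ
import Data.Nat.Tactic.RingSolver as ℕ-Solver
open import Data.Integer as ℤ using (+_)
import Data.Integer.Properties as ℤ
import Data.Integer.Tactic.RingSolver as ℤ-Solver
open import Data.Product using (_×_; _,_; proj₁; proj₂; ∃; ∃₂)
import Data.Rational.Properties as ℚ
import Data.Rational.Unnormalised as ℚᵘ
import Data.Rational.Unnormalised.Properties as ℚᵘ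
open import Data.Sum using (_⊎_; inj₁; inj₂)
import Data.Vec as Vec
open import Data.Vec.Functional using (Vector)
open import Function using (Inverse; _∘_; id)
open import Relation.Binary using (tri<; tri≈; tri>)
open import Relation.Binary.Construct.Closure.ReflexiveTransitive using (Star; ε; _◅_)
open import Relation.Binary.Construct.Closure.Symmetric using (fwd; bwd)
open import Relation.Binary.PropositionalEquality
open import Relation.Nullary using (¬_; Dec; yes; no; does; contradiction)
open import Relation.Nullary.Decidable using (_×-dec_; dec-true; dec-false)
open import Relation.Unary using () renaming (Decidable to Decidable₁)

open import Algebra.Properties.Semiring.Sum ℕ.+-*-semiring
  using (sum; sum-syntax; sum-cong-≗; ∑-distrib-+; ∑-comm)

-- Counting

𝟙 : {P : Set} → Dec P → ℕ
𝟙 P? = if does P? then 1 else 0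

𝟙-yes : {P : Set} (P? : Dec P) → P → 𝟙 P? ≡ 1
𝟙-yes P? p = cong (if_then 1 else 0) (dec-true P? p)

𝟙-no : {P : Set} (P? : Dec P) → ¬ P → 𝟙 P? ≡ 0
𝟙-no P? ¬p = cong (if_then 1 else 0) (dec-false P? ¬p)

𝟙-cong : {P Q : Set} (P? : Dec P) (Q? : Dec Q) → (P → Q) → (Q → P) → 𝟙 P? ≡ 𝟙 Q?
𝟙-cong P? (yes q) _   Q⇒P = 𝟙-yes P? (Q⇒P q)
𝟙-cong P? (no ¬q) P⇒Q _   = 𝟙-no P? (¬q ∘ P⇒Q)

∑-const : ∀ n c → ∑[ i < n ] c ≡ n * c
∑-const zero    c = refl
∑-const (suc n) c = cong (c ℕ.+_) (∑-const n c)

∑-zero : ∀ n → ∑[ i < n ] 0 ≡ 0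
∑-zero n = trans (∑-const n 0) (ℕ.*-zeroʳ n)

∑-one : ∀ n → ∑[ i < n ] 1 ≡ n
∑-one n = trans (∑-const n 1) (ℕ.*-identityʳ n)

∑-split : ∀ m {n} (f : Vector ℕ (m + n)) →
          sum f ≡ ∑[ i < m ] f (i ↑ˡ n) + ∑[ j < n ] f (m ↑ʳ j)
∑-split zero    f = refl
∑-split (suc m) f =
  trans (cong (f Fin.zero ℕ.+_) (∑-split m (f ∘ Fin.suc))) (sym (ℕ.+-assoc (f Fin.zero) _ _))

∑-𝟙≟ : ∀ {n} (i : Fin n) → ∑[ j < n ] 𝟙 (i Fin.≟ j) ≡ 1
∑-𝟙≟ {suc n} Fin.zero    = cong suc (∑-zero n)
∑-𝟙≟         (Fin.suc i) = ∑-𝟙≟ i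

∣tabulate∣ : ∀ {n} (f : Fin n → Bool) →
             ∣ Vec.tabulate f ∣ ≡ ∑[ i < n ] (if f i then 1 else 0)
∣tabulate∣ {zero}  f = refl
∣tabulate∣ {suc n} f with f Fin.zero
... | true  = cong suc (∣tabulate∣ (f ∘ Fin.suc))
... | false = ∣tabulate∣ (f ∘ Fin.suc)

module _ {A : Set} {P : A → Set} (P? : Decidable₁ P) where

  length-filter-tabulate : ∀ {n} (f : Fin n → A) →
    length (filter P? (List.tabulate f)) ≡ ∑[ i < n ] 𝟙 (P? (f i))
  length-filter-tabulate {zero}  f = refl
  length-filter-tabulate {suc n} f with does (P? (f Fin.zero))
  ... | true  = cong suc (length-filter-tabulate (f ∘ Fin.suc))
  ... | false = length-filter-tabulate (f ∘ Fin.suc)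

-- `allFin n` is `tabulate id`, whose tail is a tabulation of `suc` and not another `allFin`; an
-- arbitrary `f` lets the induction on `m` go through.
length-filter-cartesianProduct :
  ∀ {A B : Set} {P : A × B → Set} (P? : Decidable₁ P) {m n} (f : Fin m → A) (g : Fin n → B) →
  length (filter P? (cartesianProduct (List.tabulate f) (List.tabulate g)))
    ≡ ∑[ i < m ] ∑[ j < n ] 𝟙 (P? (f i , g j))
length-filter-cartesianProduct P? {zero}  f g = refl
length-filter-cartesianProduct P? {suc m} {n} f g = begin
  length (filter P? (row List.++ rest))
    ≡⟨ cong length (filter-++ P? row rest) ⟩
  length (filter P? row List.++ filter P? rest)
    ≡⟨ length-++ (filter P? row) ⟩
  length (filter P? row) + length (filter P? rest)
    ≡⟨ cong₂ _+_
         (trans (cong (length ∘ filter P?) (map-tabulate g (f Fin.zero ,_)))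
                (length-filter-tabulate P? (λ j → f Fin.zero , g j)))
         (length-filter-cartesianProduct P? (f ∘ Fin.suc) g) ⟩
  ∑[ i < suc m ] ∑[ j < n ] 𝟙 (P? (f i , g j)) ∎
  where
  open ≡-Reasoning
  row  = List.map (f Fin.zero ,_) (List.tabulate g)
  rest = cartesianProduct (List.tabulate (f ∘ Fin.suc)) (List.tabulate g)

∣p∣+∣∁p∣≡n : ∀ {n} (p : Subset n) → ∣ p ∣ + ∣ ∁ p ∣ ≡ n
∣p∣+∣∁p∣≡n p = trans (cong (∣ p ∣ ℕ.+_) (∣∁p∣≡n∸∣p∣ p)) (ℕ.m+[n∸m]≡n (∣p∣≤n p))

∣p∣≤1 : ∀ {n} (p : Subset n) → (∀ {i j} → i ∈ˢ p → j ∈ˢ p → i ≡ j) → ∣ p ∣ ≤ 1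
∣p∣≤1 {n} p unique with nonempty? p
... | yes (i , i∈p) = subst (∣ p ∣ ≤_) (∣⁅x⁆∣≡1 i)
  (p⊆q⇒∣p∣≤∣q∣ λ j∈p → subst (_∈ˢ ⁅ i ⁆) (unique i∈p j∈p) (x∈⁅x⁆ i))
... | no empty = subst (_≤ 1) (sym (trans (cong ∣_∣ (Empty-unique empty)) (∣⊥∣≡0 n))) z≤n

-- Induction by Pascal's rule. Doubling and keeping `n` on the left avoids division and truncated
-- subtraction.
2*nC2+n≡n*n : ∀ n → 2 * (n C 2) + n ≡ n * n
2*nC2+n≡n*n zero    = refl
2*nC2+n≡n*n (suc n) = begin
  2 * (suc n C 2) + suc n
    ≡⟨ cong (λ x → 2 * x + suc n) (sym (nCk+nC[k+1]≡[n+1]C[k+1] n 1)) ⟩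
  2 * (n C 1 + n C 2) + suc n
    ≡⟨ cong (λ x → 2 * (x + n C 2) + suc n) (nC1≡n n) ⟩
  2 * (n + n C 2) + suc n
    ≡⟨ rearrange n (n C 2) ⟩
  (2 * (n C 2) + n) + (2 * n + 1)
    ≡⟨ cong (_+ (2 * n + 1)) (2*nC2+n≡n*n n) ⟩
  n * n + (2 * n + 1)
    ≡⟨ square n ⟩
  suc n * suc n ∎
  where
  open ≡-Reasoning
  rearrange : ∀ n c → 2 * (n + c) + suc n ≡ (2 * c + n) + (2 * n + 1)
  rearrange = ℕ-Solver.solve-∀
  square : ∀ n → n * n + (2 * n + 1) ≡ suc n * suc n
  square = ℕ-Solver.solve-∀

-- Graphs

module _ (G : Graph) where
  open Graph G using (V; finite; _~_; _~?_; ~-sym; ~-irrefl; index; vertex; degree;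
    edgePairs; edges; IsIdentifyingVertexCover; isIdentifyingVertexCover?;
    ⊤-isIdentifyingVertexCover; walkLength; Distance≥; IsPacking; isPacking?)

  vertex-index : ∀ v → vertex (index v) ≡ v
  vertex-index = Inverse.strictlyInverseʳ finite

  index-vertex : ∀ i → index (vertex i) ≡ i
  index-vertex = Inverse.strictlyInverseˡ finite

  degree-∑ : ∀ v → degree v ≡ ∑[ i < order G ] 𝟙 (v ~? vertex i)
  degree-∑ v = ∣tabulate∣ (λ i → does (v ~? vertex i))

  orderedEdge? : Decidable₁ λ ((i , j) : Fin (order G) × Fin (order G)) →
                              i Fin.< j × vertex i ~ vertex j
  orderedEdge? (i , j) = (i Fin.<? j) ×-dec (vertex i ~? vertex j)

  -- Double counting: `a i j` indicates membership of `(i , j)` in `edgePairs`. An adjacent ordered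
  -- pair is listed in exactly one of its two orientations, and exchanging the order of summation
  -- shows that both orientations contribute equally.
  handshake : ∑[ i < order G ] degree (vertex i) ≡ 2 * size G
  handshake = begin
    ∑[ i < n ] degree (vertex i)
      ≡⟨ sum-cong-≗ (λ i → degree-∑ (vertex i)) ⟩
    ∑[ i < n ] ∑[ j < n ] 𝟙 (vertex i ~? vertex j)
      ≡⟨ sum-cong-≗ (λ i → sum-cong-≗ (orient i)) ⟩
    ∑[ i < n ] ∑[ j < n ] (a i j + a j i)
      ≡⟨ sum-cong-≗ (λ i → ∑-distrib-+ (a i) (λ j → a j i)) ⟩
    ∑[ i < n ] (∑[ j < n ] a i j + ∑[ j < n ] a j i)
      ≡⟨ ∑-distrib-+ (λ i → ∑[ j < n ] a i j) _ ⟩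
    ∑[ i < n ] ∑[ j < n ] a i j + ∑[ i < n ] ∑[ j < n ] a j i
      ≡⟨ cong₂ _+_ refl (∑-comm (λ i j → a j i)) ⟩
    ∑[ i < n ] ∑[ j < n ] a i j + ∑[ i < n ] ∑[ j < n ] a i j
      -- `2 * size G` unfolds to `size G + 1 * size G`, so the second summand first sheds its factor
      -- 1.
      ≡⟨ cong₂ _+_ size-∑ (trans (ℕ.*-identityˡ _) size-∑) ⟨
    2 * size G ∎
    where
    open ≡-Reasoning
    n = order G
    a : Fin n → Fin n → ℕ
    a i j = 𝟙 (orderedEdge? (i , j))
    size-∑ : size G ≡ ∑[ i < n ] ∑[ j < n ] a i j
    size-∑ = trans (length-map _ edgePairs) (length-filter-cartesianProduct orderedEdge? id id)
    orient : ∀ i j → 𝟙 (vertex i ~? vertex j) ≡ a i j + a j i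
    orient i j with Fin.<-cmp i j
    ... | tri< i<j _ j≮i = trans
      (𝟙-cong (vertex i ~? vertex j) (orderedEdge? (i , j)) (i<j ,_) proj₂)
      (sym (trans (cong (a i j ℕ.+_) (𝟙-no (orderedEdge? (j , i)) (j≮i ∘ proj₁)))
                  (ℕ.+-identityʳ (a i j))))
    ... | tri≈ i≮i refl _ = trans
      (𝟙-no (vertex i ~? vertex i) (~-irrefl refl))
      (sym (cong₂ _+_ (𝟙-no (orderedEdge? (i , i)) (i≮i ∘ proj₁))
                      (𝟙-no (orderedEdge? (i , i)) (i≮i ∘ proj₁))))
    ... | tri> i≮j _ j<i = trans
      (𝟙-cong (vertex i ~? vertex j) (orderedEdge? (j , i))
        (λ i~j → j<i , ~-sym i~j) (~-sym ∘ proj₂))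
      (sym (cong (_+ a j i) (𝟙-no (orderedEdge? (i , j)) (i≮j ∘ proj₁))))

  maxDegree-attained : ∀ {k} v → degree v ≡ k → (∀ u → degree u ≤ k) → maxDegree G ≡ k
  maxDegree-attained v refl degree≤ = ℕ.≤-antisym
    -- `z≤n` accounts for the default value 0 in the list maximum.
    (max≤v⁺ z≤n (All.map⁺ (All.universal (λ i → degree≤ (vertex i)) (allFin (order G)))))
    (v≤max⁺ 0 _ (inj₂ (lose
      (∈-map⁺ (λ i → degree (vertex i)) (∈-allFin (index v)))
      (ℕ.≤-reflexive (cong degree (sym (vertex-index v)))))))

  -- Edges as two-element sets of vertices

  -- Takes its endpoints in either order, whereas `edges` lists each edge with the smaller index
  -- first; a chosen endpoint can thus be put in front.
  edge : V → V → Subset (order G)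
  edge u v = ⁅ index u ⁆ ∪ ⁅ index v ⁆

  edge-comm : ∀ u v → edge u v ≡ edge v u
  edge-comm u v = ∪-comm ⁅ index u ⁆ ⁅ index v ⁆

  ∈-edgeˡ : ∀ u v → index u ∈ˢ edge u v
  ∈-edgeˡ u v = x∈p∪q⁺ (inj₁ (x∈⁅x⁆ _))

  ∈-edgeʳ : ∀ u v → index v ∈ˢ edge u v
  ∈-edgeʳ u v = x∈p∪q⁺ (inj₂ (x∈⁅x⁆ _))

  ∈-edge⁻ : ∀ {i} u v → i ∈ˢ edge u v → i ≡ index u ⊎ i ≡ index v
  ∈-edge⁻ u v i∈ with x∈p∪q⁻ ⁅ index u ⁆ _ i∈
  ... | inj₁ i∈u = inj₁ (x∈⁅y⁆⇒x≡y _ i∈u)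
  ... | inj₂ i∈v = inj₂ (x∈⁅y⁆⇒x≡y _ i∈v)

  index-injective : ∀ {u v} → index u ≡ index v → u ≡ v
  index-injective {u} {v} eq =
    trans (sym (vertex-index u)) (trans (cong vertex eq) (vertex-index v))

  edge∈edges-< : ∀ {u v} → index u Fin.< index v → u ~ v → edge u v ∈ edges
  edge∈edges-< {u} {v} u<v u~v = ∈-map⁺ _ (∈-filter⁺ orderedEdge?
    (∈-cartesianProduct⁺ (∈-allFin (index u)) (∈-allFin (index v)))
    (u<v , subst₂ _~_ (sym (vertex-index u)) (sym (vertex-index v)) u~v))

  edge∈edges : ∀ {u v} → u ~ v → edge u v ∈ edges
  edge∈edges {u} {v} u~v with Fin.<-cmp (index u) (index v)
  ... | tri< u<v _ _ = edge∈edges-< u<v u~v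
  ... | tri≈ _ u≡v _ = contradiction u~v (~-irrefl (index-injective u≡v))
  ... | tri> _ _ v<u = subst (_∈ edges) (edge-comm v u) (edge∈edges-< v<u (~-sym u~v))

  edges⁻ : ∀ {e} → e ∈ edges → ∃₂ λ u v → u ~ v × e ≡ edge u v
  edges⁻ e∈ with ∈-map⁻ _ e∈
  ... | (i , j) , ij∈ , refl =
    vertex i , vertex j , proj₂ (proj₂ (∈-filter⁻ orderedEdge? {xs = cartesianProduct (allFin _) (allFin _)} ij∈)) ,
    cong₂ (λ i j → ⁅ i ⁆ ∪ ⁅ j ⁆) (sym (index-vertex i)) (sym (index-vertex j))

  -- Puts a known endpoint first, so that two edges sharing `u` can be compared by their other ends.
  incident : ∀ {e} u → e ∈ edges → index u ∈ˢ e → ∃ λ v → u ~ v × e ≡ edge u v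
  incident u e∈ u∈e with edges⁻ e∈
  ... | p , q , p~q , refl with ∈-edge⁻ p q u∈e
  ...   | inj₁ u≡p rewrite index-injective u≡p = q , p~q , refl
  ...   | inj₂ u≡q rewrite index-injective u≡q = p , ~-sym p~q , edge-comm p q

  -- An end outside `T` leaves no mark on the trace, so edges from `u` to different vertices outside
  -- `T` cannot be told apart.
  edge-∩ : ∀ {T} u {v} → index v ∉ T → edge u v ∩ T ≡ ⁅ index u ⁆ ∩ T
  edge-∩ {T} u {v} v∉T = ⊆-antisym to from
    where
    to : ∀ {i} → i ∈ˢ edge u v ∩ T → i ∈ˢ ⁅ index u ⁆ ∩ T
    to i∈ with x∈p∩q⁻ (edge u v) T i∈
    ... | i∈e , i∈T with ∈-edge⁻ u v i∈e
    ...   | inj₁ refl = x∈p∩q⁺ (x∈⁅x⁆ _ , i∈T)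
    ...   | inj₂ refl = contradiction i∈T v∉T
    from : ∀ {i} → i ∈ˢ ⁅ index u ⁆ ∩ T → i ∈ˢ edge u v ∩ T
    from i∈ with x∈p∩q⁻ ⁅ index u ⁆ T i∈
    ... | i∈u , i∈T = x∈p∩q⁺ (x∈p∪q⁺ (inj₁ i∈u) , i∈T)

  -- Complements of identifying vertex covers and of packings

  -- Walks shorter than three are excluded by length: length 0 contradicts `u ≢ v`, length 1 gives
  -- an edge that misses `T`, and length 2 gives two edges with the same trace on `T`.
  identifying⇒∁-packing : ∀ {T} → IsIdentifyingVertexCover T → IsPacking (∁ T)
  identifying⇒∁-packing {T} (cover , identify) u v u∈∁T v∈∁T u≢v = far
    where
    u∉T = x∈∁p⇒x∉p u∈∁T
    v∉T = x∈∁p⇒x∉p v∈∁T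
    far : Distance≥ 3 u v
    far ε = contradiction refl u≢v
    far (u~v ◅ ε) with cover _ (edge∈edges u~v)
    ... | i , i∈ with x∈p∩q⁻ (edge u v) T i∈
    ...   | i∈e , i∈T with ∈-edge⁻ u v i∈e
    ...     | inj₁ refl = contradiction i∈T u∉T
    ...     | inj₂ refl = contradiction i∈T v∉T
    -- The edges from the midpoint `x` to `u` and to `v` differ, yet both meet `T` in the trace of
    -- `x` alone.
    far (_◅_ {j = x} u~x (x~v ◅ ε)) =
      ⊥-elim (identify _ _ (edge∈edges (~-sym u~x)) (edge∈edges x~v) xu≢xv
        (trans (edge-∩ x u∉T) (sym (edge-∩ x v∉T))))
      where
      xu≢xv : edge x u ≢ edge x v
      xu≢xv eq with ∈-edge⁻ x v (subst (index u ∈ˢ_) eq (∈-edgeʳ x u))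
      ... | inj₁ u≡x = ~-irrefl (index-injective u≡x) u~x
      ... | inj₂ u≡v = u≢v (index-injective u≡v)
    far (_ ◅ _ ◅ _ ◅ _) = s≤s (s≤s (s≤s z≤n))

  -- Members of `S` are never adjacent, so every edge has an end outside `S`. Distinct edges with
  -- equal traces would share such an end `u`, and their other ends would be two members of `S`
  -- joined by a walk of length two through `u`.
  packing⇒∁-identifying : ∀ {S} → IsPacking S → IsIdentifyingVertexCover (∁ S)
  packing⇒∁-identifying {S} packing = cover , identify
    where
    outside : ∀ {e} → e ∈ edges → ∃₂ λ u v → index u ∉ S × u ~ v × e ≡ edge u v
    outside e∈ with edges⁻ e∈
    ... | u , v , u~v , refl with index u ∈? S | index v ∈? S
    ...   | no u∉S  | _       = u , v , u∉S , u~v , refl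
    ...   | yes _   | no v∉S  = v , u , v∉S , ~-sym u~v , edge-comm u v
    ...   | yes u∈S | yes v∈S
      -- The walk along this edge has length one, so the packing condition would say `3 ≤ 1`.
      with () ← ℕ.≤-pred (packing u v u∈S v∈S (λ u≡v → ~-irrefl u≡v u~v) (u~v ◅ ε))

    cover : ∀ e → e ∈ edges → _
    cover e e∈ with outside e∈
    ... | u , v , u∉S , u~v , refl = index u , x∈p∩q⁺ (∈-edgeˡ u v , x∉p⇒x∈∁p u∉S)

    ∈-transfer : ∀ {e f i} → e ∩ ∁ S ≡ f ∩ ∁ S → i ∈ˢ e → i ∉ S → i ∈ˢ f
    ∈-transfer {f = f} eq i∈e i∉S =
      proj₁ (x∈p∩q⁻ f (∁ S) (subst (_ ∈ˢ_) eq (x∈p∩q⁺ (i∈e , x∉p⇒x∈∁p i∉S))))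

    -- If `v` were outside `S`, it would belong to the common trace and hence be an end of the other
    -- edge, that is, equal to `u` or `w`.
    other-end∈S : ∀ {u v w} → u ~ v → v ≢ w → edge u v ∩ ∁ S ≡ edge u w ∩ ∁ S → index v ∈ˢ S
    other-end∈S {u} {v} {w} u~v v≢w eq with index v ∈? S
    ... | yes v∈S = v∈S
    ... | no  v∉S with ∈-edge⁻ u w (∈-transfer eq (∈-edgeʳ u v) v∉S)
    ...   | inj₁ v≡u = contradiction u~v (~-irrefl (sym (index-injective v≡u)))
    ...   | inj₂ v≡w = contradiction (index-injective v≡w) v≢w

    identify : ∀ e f → e ∈ edges → f ∈ edges → e ≢ f → e ∩ ∁ S ≢ f ∩ ∁ S
    identify e f e∈ f∈ e≢f eq with outside e∈
    ... | u , v , u∉S , u~v , refl with incident u f∈ (∈-transfer eq (∈-edgeˡ u v) u∉S)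
    ...   | w , u~w , refl = ℕ.1+n≰n (packing v w
      (other-end∈S u~v v≢w eq) (other-end∈S u~w (v≢w ∘ sym) (sym eq)) v≢w
      (~-sym u~v ◅ u~w ◅ ε))
      where
      v≢w : v ≢ w
      v≢w v≡w = e≢f (cong (edge u) v≡w)

  τD-attained : ∃ λ T → IsIdentifyingVertexCover T × ∣ T ∣ ≡ τD G
  τD-attained = proj₁ (proj₂ (minCardinality isIdentifyingVertexCover? (_ , ⊤-isIdentifyingVertexCover)))

  τD≤ : ∀ T → IsIdentifyingVertexCover T → τD G ≤ ∣ T ∣
  τD≤ = proj₂ (proj₂ (minCardinality isIdentifyingVertexCover? (_ , ⊤-isIdentifyingVertexCover)))

  ρ-attained : ∃ λ S → IsPacking S × ∣ S ∣ ≡ ρ G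
  ρ-attained = proj₁ (proj₂ (maxCardinality isPacking? _))

  ≤ρ : ∀ S → IsPacking S → ∣ S ∣ ≤ ρ G
  ≤ρ = proj₂ (proj₂ (maxCardinality isPacking? _))

  -- The complement of a largest packing bounds `τD` from above, and the complement of a smallest
  -- identifying vertex cover bounds `ρ` from below.
  τD+ρ≡order : τD G + ρ G ≡ order G
  τD+ρ≡order =
    let S , packing     , ∣S∣≡ρ  = ρ-attained
        T , identifying , ∣T∣≡τD = τD-attained
    in ℕ.≤-antisym
      (≤-complement S (τD≤ (∁ S) (packing⇒∁-identifying packing)) ∣S∣≡ρ)
      (complement-≤ T ∣T∣≡τD (≤ρ (∁ T) (identifying⇒∁-packing identifying)))
    where
    ≤-complement : ∀ {n k l} (p : Subset n) → k ≤ ∣ ∁ p ∣ → ∣ p ∣ ≡ l → k + l ≤ n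
    ≤-complement {k = k} p k≤ refl = subst (k + ∣ p ∣ ≤_)
      (trans (ℕ.+-comm ∣ ∁ p ∣ ∣ p ∣) (∣p∣+∣∁p∣≡n p)) (ℕ.+-monoˡ-≤ ∣ p ∣ k≤)
    complement-≤ : ∀ {n k l} (p : Subset n) → ∣ p ∣ ≡ k → ∣ ∁ p ∣ ≤ l → n ≤ k + l
    complement-≤ {l = l} p refl ≤l = subst (_≤ ∣ p ∣ + l) (∣p∣+∣∁p∣≡n p) (ℕ.+-monoʳ-≤ ∣ p ∣ ≤l)

  -- Diameter at most two

  -- Carries an explicit walk, so that connectedness can be read off as well.
  Distance≤ : ℕ → V → V → Set
  Distance≤ k u v = ∃ λ (w : Star _~_ u v) → walkLength w ≤ k

  -- Two distinct members of a packing would have a walk of length at most two between them; a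
  -- singleton is a packing vacuously.
  diameter≤2⇒ρ≡1 : V → (∀ u v → Distance≤ 2 u v) → ρ G ≡ 1
  diameter≤2⇒ρ≡1 v₀ close = ℕ.≤-antisym ρ≤1 1≤ρ
    where
    ρ≤1 : ρ G ≤ 1
    ρ≤1 with ρ-attained
    ... | S , packing , ∣S∣≡ρ = subst (_≤ 1) ∣S∣≡ρ (∣p∣≤1 S unique)
      where
      unique : ∀ {i j} → i ∈ˢ S → j ∈ˢ S → i ≡ j
      unique {i} {j} i∈S j∈S with i Fin.≟ j
      ... | yes i≡j = i≡j
      ... | no  i≢j with close (vertex i) (vertex j)
      ...   | w , w≤2 = contradiction
        (ℕ.≤-trans (packing (vertex i) (vertex j)
          (subst (_∈ˢ S) (sym (index-vertex i)) i∈S)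
          (subst (_∈ˢ S) (sym (index-vertex j)) j∈S)
          (λ eq → i≢j (trans (sym (index-vertex i)) (trans (cong index eq) (index-vertex j)))) w)
          w≤2)
        ℕ.1+n≰n
    1≤ρ : 1 ≤ ρ G
    1≤ρ = subst (_≤ ρ G) (∣⁅x⁆∣≡1 (index v₀)) (≤ρ ⁅ index v₀ ⁆ λ u v u∈ v∈ u≢v →
      contradiction (index-injective (trans (x∈⁅y⁆⇒x≡y _ u∈) (sym (x∈⁅y⁆⇒x≡y _ v∈)))) u≢v)

  -- Multiplying the bound by its positive denominator and moving everything to one side gives `μ`.
  satisfiesBound⇒0≤μ : SatisfiesBound G → + 0 ℤ.≤ μ G
  satisfiesBound⇒0≤μ τD≤bound = ℤ.i≤j⇒0≤j-i {i = (+ Δ ℤ.* + Δ ℤ.+ + 1) ℤ.* + τD G}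
    (subst₂ ℤ._≤_ lhs (ℤ.*-identityʳ numerator) crossed)
    where
    Δ = maxDegree G
    numerator = + Δ ℤ.* (+ Δ ℤ.- + 1) ℤ.* + order G ℤ.+ + 2 ℤ.* + size G
    crossed : + τD G ℤ.* + suc (Δ ^ 2) ℤ.≤ numerator ℤ.* + 1
    -- Division in `ℚ` reduces to lowest terms, so the inequality is moved to the equivalent
    -- unreduced fractions before cross-multiplying. `mkℚᵘ` takes the denominator minus one, hence
    -- `0` and `Δ ^ 2`.
    crossed = ℚᵘ.drop-*≤* (ℚᵘ.≤-respˡ-≃ (ℚ.toℚᵘ-fromℚᵘ (ℚᵘ.mkℚᵘ (+ τD G) 0))
      (ℚᵘ.≤-respʳ-≃ (ℚ.toℚᵘ-fromℚᵘ (ℚᵘ.mkℚᵘ numerator (Δ ^ 2))) (ℚ.toℚᵘ-mono-≤ τD≤bound)))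
    suc-Δ² : + suc (Δ ^ 2) ≡ + Δ ℤ.* + Δ ℤ.+ + 1
    suc-Δ² = begin
      + suc (Δ ^ 2)           ≡⟨ cong +_ (trans (cong (suc ∘ (Δ *_)) (ℕ.*-identityʳ Δ)) (ℕ.+-comm 1 (Δ * Δ))) ⟩
      + (Δ * Δ) ℤ.+ + 1       ≡⟨ cong (ℤ._+ + 1) (ℤ.pos-* Δ Δ) ⟩
      + Δ ℤ.* + Δ ℤ.+ + 1     ∎
      where open ≡-Reasoning
    lhs : + τD G ℤ.* + suc (Δ ^ 2) ≡ (+ Δ ℤ.* + Δ ℤ.+ + 1) ℤ.* + τD G
    lhs = trans (cong (+ τD G ℤ.*_) suc-Δ²) (ℤ.*-comm (+ τD G) _)

-- The graphs H t r

module _ (t r : ℕ) where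
  open Graph (H t r) using (vertex; degree; _~_; _~?_)

  -- The indexing lists `a`, `b` and then the blocks X, C and D consecutively. Both the individual
  -- degrees and the degree sum are computed through this splitting.
  ∑-HVertex : (f : HVertex t r → ℕ) → ∑[ i < order (H t r) ] f (vertex i) ≡
    f va + (f vb + (∑[ i < t ] f (vx i) + (∑[ j < r ] f (vc j) + ∑[ j < r ] f (vd j))))
  ∑-HVertex f = cong (λ s → f va + (f vb + s)) (trans (∑-split t _) (cong₂ _+_
    (sum-cong-≗ λ i → cong f (vertex-x i))
    (trans (∑-split r _) (cong₂ _+_
      (sum-cong-≗ λ j → cong f (vertex-c j))
      (sum-cong-≗ λ j → cong f (vertex-d j))))))
    where
    -- For variable `t` and `r` the inverse bijection is stuck on `splitAt`, so each block needs the
    -- corresponding rewrite rule.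
    vertex-x : ∀ i → vertex (2 ↑ʳ (i ↑ˡ (r + r))) ≡ vx i
    vertex-x i rewrite Fin.splitAt-↑ˡ t i (r + r) = refl
    vertex-c : ∀ j → vertex (2 ↑ʳ (t ↑ʳ (j ↑ˡ r))) ≡ vc j
    vertex-c j rewrite Fin.splitAt-↑ʳ t (r + r) (j ↑ˡ r) | Fin.splitAt-↑ˡ r j r = refl
    vertex-d : ∀ j → vertex (2 ↑ʳ (t ↑ʳ (r ↑ʳ j))) ≡ vd j
    vertex-d j rewrite Fin.splitAt-↑ʳ t (r + r) (r ↑ʳ j) | Fin.splitAt-↑ʳ r r j = refl

  -- Degrees, size and order

  degree-H : ∀ v → degree v ≡
    𝟙 (v ~? va) + (𝟙 (v ~? vb) + (∑[ i < t ] 𝟙 (v ~? vx i) +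
      (∑[ j < r ] 𝟙 (v ~? vc j) + ∑[ j < r ] 𝟙 (v ~? vd j))))
  degree-H v = trans (degree-∑ (H t r) v) (∑-HVertex (λ u → 𝟙 (v ~? u)))

  -- Adjacency to `va` is decided by constructors alone, so the class sums are already sums of ones
  -- or of zeros. Only adjacencies between C and D and within D compare indices.
  degree-a : degree va ≡ t + r
  degree-a = trans (degree-H va) (cong₂ _+_ (∑-one t)
    (trans (cong₂ _+_ (∑-one r) (∑-zero r)) (ℕ.+-identityʳ r)))

  degree-b : degree vb ≡ t + r
  degree-b = trans (degree-H vb) (cong₂ _+_ (∑-one t) (cong₂ _+_ (∑-zero r) (∑-one r)))

  degree-x : ∀ i → degree (vx i) ≡ 2
  degree-x i = trans (degree-H (vx i))
    (cong (suc ∘ suc) (cong₂ _+_ (∑-zero t) (cong₂ _+_ (∑-zero r) (∑-zero r))))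

  degree-c : ∀ j → degree (vc j) ≡ 2
  degree-c j = trans (degree-H (vc j)) (cong suc (cong₂ _+_ (∑-zero t) (cong₂ _+_ (∑-zero r)
    (trans (sum-cong-≗ λ i → 𝟙-cong (vc j ~? vd i) (j Fin.≟ i)
             (λ { (fwd (cd _)) → refl }) (λ { refl → fwd (cd j) }))
           (∑-𝟙≟ j)))))

  -- For every index `i` exactly one of `vc i` and `vd i` is a neighbour: `vc i` if `i` is `j`, and
  -- `vd i` otherwise. This gives `r` neighbours, and `vb` is one more.
  degree-d : ∀ j → degree (vd j) ≡ suc r
  degree-d j = trans (degree-H (vd j)) (cong suc (begin
    ∑[ i < t ] 0 + (∑[ i < r ] 𝟙 (vd j ~? vc i) + ∑[ i < r ] 𝟙 (vd j ~? vd i))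
      ≡⟨ cong₂ _+_ (∑-zero t) (cong₂ _+_ (sum-cong-≗ λ i →
           𝟙-cong (vd j ~? vc i) (j Fin.≟ i) (λ { (bwd (cd _)) → refl }) (λ { refl → bwd (cd j) })) refl) ⟩
    ∑[ i < r ] 𝟙 (j Fin.≟ i) + ∑[ i < r ] 𝟙 (vd j ~? vd i)
      ≡⟨ ∑-distrib-+ (λ i → 𝟙 (j Fin.≟ i)) (λ i → 𝟙 (vd j ~? vd i)) ⟨
    ∑[ i < r ] (𝟙 (j Fin.≟ i) + 𝟙 (vd j ~? vd i))
      ≡⟨ sum-cong-≗ equal-or-adjacent ⟩
    ∑[ i < r ] 1
      ≡⟨ ∑-one r ⟩
    r ∎))
    where
    open ≡-Reasoning
    equal-or-adjacent : ∀ i → 𝟙 (j Fin.≟ i) + 𝟙 (vd j ~? vd i) ≡ 1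
    equal-or-adjacent i with Fin.<-cmp j i
    ... | tri< j<i j≢i _ = cong₂ _+_ (𝟙-no (j Fin.≟ i) j≢i) (𝟙-yes (vd j ~? vd i) (fwd (dd j<i)))
    ... | tri≈ _ refl _  = cong₂ _+_ (𝟙-yes (j Fin.≟ j) refl)
      (𝟙-no (vd j ~? vd j) (Graph.~-irrefl (H t r) refl))
    ... | tri> _ j≢i i<j = cong₂ _+_ (𝟙-no (j Fin.≟ i) j≢i) (𝟙-yes (vd j ~? vd i) (bwd (dd i<j)))

  -- The size stays doubled because `μ` contains twice the size; its evaluation then involves no
  -- binomial coefficient.
  2*size-H : 2 * size (H t r) ≡ (t + r) + ((t + r) + (t * 2 + (r * 2 + r * suc r)))
  2*size-H = begin
    2 * size (H t r)
      ≡⟨ handshake (H t r) ⟨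
    ∑[ i < order (H t r) ] degree (vertex i)
      ≡⟨ ∑-HVertex degree ⟩
    degree va + (degree vb + (∑[ i < t ] degree (vx i) +
      (∑[ j < r ] degree (vc j) + ∑[ j < r ] degree (vd j))))
      ≡⟨ cong₂ _+_ degree-a (cong₂ _+_ degree-b (cong₂ _+_
           (trans (sum-cong-≗ degree-x) (∑-const t 2)) (cong₂ _+_
           (trans (sum-cong-≗ degree-c) (∑-const r 2))
           (trans (sum-cong-≗ degree-d) (∑-const r (suc r)))))) ⟩
    (t + r) + ((t + r) + (t * 2 + (r * 2 + r * suc r))) ∎
    where open ≡-Reasoning

  -- The two sides are compared after doubling, where `r * r` becomes `2 * (r C 2) + r`.
  size-H : size (H t r) ≡ 2 * t + 3 * r + (r C 2)
  size-H = ℕ.*-cancelˡ-≡ _ _ 2 (begin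
    2 * size (H t r)
      ≡⟨ 2*size-H ⟩
    (t + r) + ((t + r) + (t * 2 + (r * 2 + r * suc r)))
      ≡⟨ expand t r ⟩
    4 * t + 5 * r + r * r
      ≡⟨ cong (4 * t + 5 * r ℕ.+_) (2*nC2+n≡n*n r) ⟨
    4 * t + 5 * r + (2 * (r C 2) + r)
      ≡⟨ collect t r (r C 2) ⟩
    2 * (2 * t + 3 * r + (r C 2)) ∎)
    where
    open ≡-Reasoning
    expand : ∀ t r → (t + r) + ((t + r) + (t * 2 + (r * 2 + r * suc r))) ≡ 4 * t + 5 * r + r * r
    expand = ℕ-Solver.solve-∀
    collect : ∀ t r c → 4 * t + 5 * r + (2 * c + r) ≡ 2 * (2 * t + 3 * r + c)
    collect = ℕ-Solver.solve-∀

  order-H : order (H t r) ≡ t + 2 * r + 2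
  order-H = rearrange t r
    where
    rearrange : ∀ t r → 2 + (t + (r + r)) ≡ t + 2 * r + 2
    rearrange = ℕ-Solver.solve-∀

  -- Maximum degree, diameter and the remaining parameters

  module _ (1≤t : 1 ≤ t) where

    maxDegree-H : 1 ≤ r → maxDegree (H t r) ≡ t + r
    maxDegree-H 1≤r = maxDegree-attained (H t r) va degree-a λ where
      va     → ℕ.≤-reflexive degree-a
      vb     → ℕ.≤-reflexive degree-b
      (vx i) → subst (_≤ t + r) (sym (degree-x i)) (ℕ.+-mono-≤ 1≤t 1≤r)
      (vc j) → subst (_≤ t + r) (sym (degree-c j)) (ℕ.+-mono-≤ 1≤t 1≤r)
      (vd j) → subst (_≤ t + r) (sym (degree-d j)) (ℕ.+-monoˡ-≤ r 1≤t)

    private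
      -- Selects a common neighbour of `a` and `b`.
      i₀ : Fin t
      i₀ = Fin.fromℕ< 1≤t

      here : ∀ {v} → Distance≤ (H t r) 2 v v
      here = ε , z≤n

      adjacent : ∀ {u v} → u ~ v → Distance≤ (H t r) 2 u v
      adjacent e = e ◅ ε , s≤s z≤n

      via : ∀ {u x v} → u ~ x → x ~ v → Distance≤ (H t r) 2 u v
      via e f = e ◅ f ◅ ε , s≤s (s≤s z≤n)

    diameter-H≤2 : ∀ u v → Distance≤ (H t r) 2 u v
    diameter-H≤2 va     va     = here
    diameter-H≤2 va     vb     = via (fwd (ax i₀)) (bwd (bx i₀))
    diameter-H≤2 va     (vx i) = adjacent (fwd (ax i))
    diameter-H≤2 va     (vc j) = adjacent (fwd (ac j))
    diameter-H≤2 va     (vd j) = via (fwd (ac j)) (fwd (cd j))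
    diameter-H≤2 vb     va     = via (fwd (bx i₀)) (bwd (ax i₀))
    diameter-H≤2 vb     vb     = here
    diameter-H≤2 vb     (vx i) = adjacent (fwd (bx i))
    diameter-H≤2 vb     (vc j) = via (bwd (db j)) (bwd (cd j))
    diameter-H≤2 vb     (vd j) = adjacent (bwd (db j))
    diameter-H≤2 (vx i) va     = adjacent (bwd (ax i))
    diameter-H≤2 (vx i) vb     = adjacent (bwd (bx i))
    -- Only an upper bound is claimed, so the walk through `a` also serves when `i` equals `k`.
    diameter-H≤2 (vx i) (vx k) = via (bwd (ax i)) (fwd (ax k))
    diameter-H≤2 (vx i) (vc j) = via (bwd (ax i)) (fwd (ac j))
    diameter-H≤2 (vx i) (vd j) = via (bwd (bx i)) (bwd (db j))
    diameter-H≤2 (vc j) va     = adjacent (bwd (ac j))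
    diameter-H≤2 (vc j) vb     = via (fwd (cd j)) (fwd (db j))
    diameter-H≤2 (vc j) (vx i) = via (bwd (ac j)) (fwd (ax i))
    diameter-H≤2 (vc j) (vc k) = via (bwd (ac j)) (fwd (ac k))
    -- The midpoint is `vd j`, since D is a clique; the comparison selects the orientation of the
    -- clique edge.
    diameter-H≤2 (vc j) (vd k) with Fin.<-cmp j k
    ... | tri< j<k _ _  = via (fwd (cd j)) (fwd (dd j<k))
    ... | tri≈ _ refl _ = adjacent (fwd (cd j))
    ... | tri> _ _ k<j  = via (fwd (cd j)) (bwd (dd k<j))
    diameter-H≤2 (vd j) va     = via (bwd (cd j)) (bwd (ac j))
    diameter-H≤2 (vd j) vb     = adjacent (fwd (db j))
    diameter-H≤2 (vd j) (vx i) = via (fwd (db j)) (fwd (bx i))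
    diameter-H≤2 (vd j) (vc k) with Fin.<-cmp j k
    ... | tri< j<k _ _  = via (fwd (dd j<k)) (bwd (cd k))
    ... | tri≈ _ refl _ = adjacent (bwd (cd j))
    ... | tri> _ _ k<j  = via (bwd (dd k<j)) (bwd (cd k))
    -- All of D is adjacent to `b`, so no comparison of indices arises.
    diameter-H≤2 (vd j) (vd k) = via (fwd (db j)) (bwd (db k))

    connected-H : Connected (H t r)
    connected-H = va , λ u v → proj₁ (diameter-H≤2 u v)

    ρ-H : ρ (H t r) ≡ 1
    ρ-H = diameter≤2⇒ρ≡1 (H t r) va diameter-H≤2

    τD-H : τD (H t r) ≡ t + 2 * r + 1
    τD-H = cancel (τD+ρ≡order (H t r)) ρ-H order-H
      where
      cancel : ∀ {τ ρ n k} → τ + ρ ≡ n → ρ ≡ 1 → n ≡ k + 2 → τ ≡ k + 1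
      cancel {τ} {k = k} eq refl refl = ℕ.+-cancelʳ-≡ 1 τ (k + 1) (trans eq (sym (ℕ.+-assoc k 1 1)))

    -- Once the parameters are substituted and the casts pushed inwards, a polynomial identity in
    -- `t` and `r` over the integers remains.
    μ-H : 1 ≤ r → μ (H t r) ≡ ℤ.- ((+ t ℤ.- + 1) ℤ.* (+ r ℤ.- + 1))
    μ-H 1≤r = compute {m = size (H t r)} (maxDegree-H 1≤r) order-H 2*size-H τD-H
      where
      open ≡-Reasoning
      -- The cast `+_` commutes with addition definitionally, so only products need `pos-*`.
      pos-linear : ∀ a b k → + (a + 2 * b + k) ≡ + a ℤ.+ + 2 ℤ.* + b ℤ.+ + k
      pos-linear a b k = cong (λ x → + a ℤ.+ x ℤ.+ + k) (ℤ.pos-* 2 b)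
      pos-twice-size : + ((t + r) + ((t + r) + (t * 2 + (r * 2 + r * suc r)))) ≡
        (+ t ℤ.+ + r) ℤ.+ ((+ t ℤ.+ + r) ℤ.+ (+ t ℤ.* + 2 ℤ.+ (+ r ℤ.* + 2 ℤ.+ + r ℤ.* (+ 1 ℤ.+ + r))))
      pos-twice-size = cong₂ (λ x y → + (t + r) ℤ.+ (+ (t + r) ℤ.+ (x ℤ.+ y))) (ℤ.pos-* t 2)
        (cong₂ ℤ._+_ (ℤ.pos-* r 2) (ℤ.pos-* r (suc r)))
      polynomial : ∀ t r → (t ℤ.+ r) ℤ.* (t ℤ.+ r ℤ.- + 1) ℤ.* (t ℤ.+ + 2 ℤ.* r ℤ.+ + 2)
        ℤ.+ ((t ℤ.+ r) ℤ.+ ((t ℤ.+ r) ℤ.+ (t ℤ.* + 2 ℤ.+ (r ℤ.* + 2 ℤ.+ r ℤ.* (+ 1 ℤ.+ r)))))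
        ℤ.- ((t ℤ.+ r) ℤ.* (t ℤ.+ r) ℤ.+ + 1) ℤ.* (t ℤ.+ + 2 ℤ.* r ℤ.+ + 1)
        ≡ ℤ.- ((t ℤ.- + 1) ℤ.* (r ℤ.- + 1))
      polynomial = ℤ-Solver.solve-∀
      -- With variables in place of the parameters, three of the equations can be matched with
      -- `refl`. For `m` only the double is known, so that equation is used by rewriting.
      compute : ∀ {Δ n m τ} → Δ ≡ t + r → n ≡ t + 2 * r + 2 →
        2 * m ≡ (t + r) + ((t + r) + (t * 2 + (r * 2 + r * suc r))) → τ ≡ t + 2 * r + 1 →
        + Δ ℤ.* (+ Δ ℤ.- + 1) ℤ.* + n ℤ.+ + 2 ℤ.* + m ℤ.- (+ Δ ℤ.* + Δ ℤ.+ + 1) ℤ.* + τ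
          ≡ ℤ.- ((+ t ℤ.- + 1) ℤ.* (+ r ℤ.- + 1))
      compute {m = m} refl refl 2m≡ refl = begin
        d ℤ.* (d ℤ.- + 1) ℤ.* + (t + 2 * r + 2) ℤ.+ + 2 ℤ.* + m
          ℤ.- (d ℤ.* d ℤ.+ + 1) ℤ.* + (t + 2 * r + 1)
          ≡⟨ cong₂ (λ x y → x ℤ.- (d ℤ.* d ℤ.+ + 1) ℤ.* y)
               (cong₂ (λ x y → d ℤ.* (d ℤ.- + 1) ℤ.* x ℤ.+ y) (pos-linear t r 2)
                 (trans (sym (ℤ.pos-* 2 m)) (trans (cong +_ 2m≡) pos-twice-size)))
               (pos-linear t r 1) ⟩
        _ ≡⟨ polynomial (+ t) (+ r) ⟩
        ℤ.- ((+ t ℤ.- + 1) ℤ.* (+ r ℤ.- + 1)) ∎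
        where d = + (t + r)

theorem3p1 : (t r : ℕ) → 2 ≤ t → 2 ≤ r →
    Connected (H t r)
    × order (H t r) ≡ t + 2 * r + 2
    × size (H t r) ≡ 2 * t + 3 * r + (r C 2)
    × maxDegree (H t r) ≡ t + r
    × ρ (H t r) ≡ 1
    × τD (H t r) ≡ t + 2 * r + 1
    × μ (H t r) ≡ ℤ.- ((+ t ℤ.- + 1) ℤ.* (+ r ℤ.- + 1))
    × ℤ.- ((+ t ℤ.- + 1) ℤ.* (+ r ℤ.- + 1)) ℤ.< + 0
    × ¬ SatisfiesBound (H t r)
theorem3p1 t@(suc (suc _)) r@(suc (suc _)) (s≤s (s≤s _)) (s≤s (s≤s _)) =
  connected-H t r 1≤t , order-H t r , size-H t r , maxDegree-H t r 1≤t 1≤r ,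
  ρ-H t r 1≤t , τD-H t r 1≤t , μ≡ , negative , λ bound →
    ℤ.<⇒≱ negative (subst (+ 0 ℤ.≤_) μ≡ (satisfiesBound⇒0≤μ (H t r) bound))
  where
  1≤t : 1 ≤ t
  1≤t = s≤s z≤n
  1≤r : 1 ≤ r
  1≤r = s≤s z≤n
  μ≡ = μ-H t r 1≤t 1≤r
  negative : ℤ.- ((+ t ℤ.- + 1) ℤ.* (+ r ℤ.- + 1)) ℤ.< + 0
  -- As `t` and `r` are matched as double successors, both factors compute to positive integers and
  -- the negated product to a negative constructor.
  negative = ℤ.-<+
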